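{- Let $a,b,n\ge 1$ be integers. The Horadam cube $\Pi^{a,b}_n$ can be decomposed into $F_{n+1}$ grids, i.e. its vertex set can be partitioned into $F_{n+1}$ nonempty sets, each of which induces a subgraph of $\Pi^{a,b}_n$ isomorphic to a grid. Moreover, let $\Pi^{a,b}_n/\rho$ be the quotient graph obtained from $\Pi^{a,b}_n$ by identifying all vertices having the same image under $\rho$, where two distinct vertices $w_1,w_2$ of $\Pi^{a,b}_n/\rho$ (regarded as elements of the image of $\rho$) are adjacent if and only if there is at least one edge of $\Pi^{a,b}_n$ connecting a vertex of $\rho^{ -1}(w_1)$ with a vertex of $\rho^{ -1}(w_2)$. Then $\Pi^{a,b}_n/\rho$ is isomorphic to the Fibonacci cube $\Gamma_{n-1}$.
   Context: For integers $a,b\ge1$ and $n\ge 0$, $\mathcal S^{a,b}_n$ is the set of all strings of length $n$ over the alphabet $\{0,1,\dots,a+b-1\}$ in which every letter from $\{a,\dots,a+b-1\}$ appears only immediately after a letter $0$. The Horadam cube $\Pi^{a,b}_n$ is the simple graph with vertex set $\mathcal S^{a,b}_n$ in which $x_1\cdots x_n$ and $y_1\cdots y_n$ are adjacent if and only if $\sum_{i=1}^n|x_i-y_i|=1$. A Fibonacci string of length $n$ is a binary string of length $n$ with no two consecutive $1$s; the Fibonacci cube $\Gamma_n$ is the graph on the Fibonacci strings of length $n$, two being adjacent if they differ in exactly one position ($\Gamma_0$ is a single vertex). $F_n$ is the $n$-th Fibonacci number, $F_0=0$, $F_1=1$, $F_n=F_{n-1}+F_{n-2}$, so there are $F_{n+2}$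 Fibonacci strings of length $n$. The map $\rho$ from $V(\Pi^{a,b}_n)$ to Fibonacci strings of length $n$ is applied letter by letter: $\rho(x)=0$ if $0\le x\le a-1$ and $\rho(x)=1$ if $x\ge a$. $P_m$ is the path graph with $m$ vertices. A grid is a Cartesian product of path graphs. -}

module Defs where

open import Data.Bool.Base using (Bool; true)
open import Data.Bool.Properties using (T-≡)
open import Data.Fin.Base using (Fin; toℕ)
open import Data.Fin.Properties using (toℕ-injective)
open import Data.List.Base using (List; foldr; map)
open import Data.Nat.Base
  using (ℕ; zero; suc; _+_; _≤_; _≤ᵇ_; ∣_-_∣; NonZero; >-nonZero⁻¹)
open import Data.Nat.Properties
  using (∣-∣-comm; ∣n-n∣≡0; ≤ᵇ⇒≤; <-irrefl; <-≤-trans; 0≢1+n; suc-injective)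
open import Data.Product using (∃!; ∃-syntax; _×_; _,_)
import Data.Product as Product
open import Data.Refinement using (Refinement-syntax; value)
import Data.Refinement as Refinement
open import Data.Sum.Base using (_⊎_; inj₁; inj₂)
import Data.Sum.Base as Sum
open import Data.Vec.Base using (Vec; []; _∷_; lookup; sum; zipWith)
import Data.Vec.Base as Vec
open import Data.Vec.Properties using (zipWith-comm; lookup-map)
open import Function.Bundles using (_↔_; _⇔_; Inverse; Equivalence)
open import Level using (0ℓ)
open import Relation.Binary.Core using (Rel)
open import Relation.Binary.Definitions using (Symmetric)
open import Relation.Binary.PropositionalEquality
  using (_≡_; _≢_; refl; sym; trans; cong; cong₂; ≢-sym)
open import Relation.Nullary using (¬_)
open import Relation.Unary using (Pred; Satisfiable)

fib : ℕ → ℕ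
fib 0             = 0
fib 1             = 1
fib (suc (suc n)) = fib (suc n) + fib n

------------------------------------------------------------------------
-- Simple graphs

record Graph : Set₁ where
  field
    Vertex     : Set
    Adj        : Rel Vertex 0ℓ
    Adj-sym    : Symmetric Adj
    Adj-irrefl : ∀ {v} → ¬ Adj v v

open Graph public using (Vertex)

infix 4 _≅_
record _≅_ (G H : Graph) : Set where
  field
    vertices : Vertex G ↔ Vertex H
    adjacent : ∀ u v →
      Graph.Adj G u v ⇔
      Graph.Adj H (Inverse.to vertices u) (Inverse.to vertices v)

-- Refinement types carry irrelevant membership proofs, so two vertices of
-- an induced subgraph are equal as soon as they are equal in G.
induced : (G : Graph) → Pred (Vertex G) 0ℓ → Graph
induced G P = record
  { Vertex     = [ v ∈ Vertex G ∣ P v ]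
  ; Adj        = λ u v → Graph.Adj G (value u) (value v)
  ; Adj-sym    = Graph.Adj-sym G
  ; Adj-irrefl = Graph.Adj-irrefl G
  }

-- Identify the vertices of G that have the same image under f; the
-- resulting vertices are represented by the elements of the image of f.
quotient : (G : Graph) {W : Set} → (Vertex G → W) → Graph
quotient G {W} f = record
  { Vertex     = [ w ∈ W ∣ ∃[ v ] f v ≡ w ]
  ; Adj        = λ w₁ w₂ → w₁ ≢ w₂ ×
      ∃[ v₁ ] ∃[ v₂ ] f v₁ ≡ value w₁ × f v₂ ≡ value w₂ × Graph.Adj G v₁ v₂
  ; Adj-sym    = λ (w₁≢w₂ , v₁ , v₂ , p₁ , p₂ , e) →
      ≢-sym w₁≢w₂ , v₂ , v₁ , p₂ , p₁ , Graph.Adj-sym G e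
  ; Adj-irrefl = λ (w≢w , _) → w≢w refl
  }

path : ℕ → Graph
path m = record
  { Vertex     = Fin m
  ; Adj        = λ i j → ∣ toℕ i - toℕ j ∣ ≡ 1
  ; Adj-sym    = λ {i} {j} → trans (∣-∣-comm (toℕ j) (toℕ i))
  ; Adj-irrefl = λ {i} e → 0≢1+n (trans (sym (∣n-n∣≡0 (toℕ i))) e)
  }

infixr 5 _□_
_□_ : Graph → Graph → Graph
G □ H = record
  { Vertex     = Vertex G × Vertex H
  ; Adj        = λ (g , h) (g′ , h′) →
      (g ≡ g′ × Graph.Adj H h h′) ⊎ (Graph.Adj G g g′ × h ≡ h′)
  ; Adj-sym    = Sum.map (Product.map sym (Graph.Adj-sym H))
                         (Product.map (Graph.Adj-sym G) sym)
  ; Adj-irrefl = λ { (inj₁ (_ , e)) → Graph.Adj-irrefl H e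
                   ; (inj₂ (e , _)) → Graph.Adj-irrefl G e }
  }

-- path 1 is the unit of □, so the trailing factor does not matter up to
-- isomorphism.
grid : List ℕ → Graph
grid ms = foldr _□_ (path 1) (map path ms)

IsGrid : Graph → Set
IsGrid G = ∃[ ms ] G ≅ grid ms

record IsPartition {V : Set} {k : ℕ} (part : Fin k → Pred V 0ℓ) : Set where
  field
    nonempty : ∀ i → Satisfiable (part i)
    -- The parts cover V and are pairwise disjoint.
    covers!  : ∀ v → ∃! _≡_ (λ i → part i v)

DecomposesIntoGrids : Graph → ℕ → Set₁
DecomposesIntoGrids G k =
  ∃[ part ] IsPartition {Vertex G} {k} part × (∀ i → IsGrid (induced G (part i)))

------------------------------------------------------------------------
-- Horadam cubes

IsHoradam : ∀ a b {n} → Pred (Vec (Fin (a + b)) n) 0ℓ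
IsHoradam a b s = ∀ j → a ≤ toℕ (lookup s j) →
  ∃[ i ] toℕ j ≡ suc (toℕ i) × toℕ (lookup s i) ≡ 0

HoradamString : ℕ → ℕ → ℕ → Set
HoradamString a b n = [ s ∈ Vec (Fin (a + b)) n ∣ IsHoradam a b s ]

distance : ∀ {m n} → Vec (Fin m) n → Vec (Fin m) n → ℕ
distance xs ys = sum (zipWith (λ x y → ∣ toℕ x - toℕ y ∣) xs ys)

distance-comm : ∀ {m n} (xs ys : Vec (Fin m) n) → distance xs ys ≡ distance ys xs
distance-comm xs ys =
  cong sum (zipWith-comm (λ x y → ∣-∣-comm (toℕ x) (toℕ y)) xs ys)

distance-self : ∀ {m n} (xs : Vec (Fin m) n) → distance xs xs ≡ 0
distance-self []       = refl
distance-self (x ∷ xs) = cong₂ _+_ (∣n-n∣≡0 (toℕ x)) (distance-self xs)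

Π : ℕ → ℕ → ℕ → Graph
Π a b n = record
  { Vertex     = HoradamString a b n
  ; Adj        = λ x y → distance (value x) (value y) ≡ 1
  ; Adj-sym    = λ {x} {y} → trans (distance-comm (value y) (value x))
  ; Adj-irrefl = λ {x} e → 0≢1+n (trans (sym (distance-self (value x))) e)
  }

------------------------------------------------------------------------
-- Fibonacci cubes; the bits 0 and 1 are false and true

IsFibonacci : ∀ {n} → Pred (Vec Bool n) 0ℓ
IsFibonacci s = ∀ i j → toℕ j ≡ suc (toℕ i) →
  ¬ (lookup s i ≡ true × lookup s j ≡ true)

FibonacciString : ℕ → Set
FibonacciString n = [ s ∈ Vec Bool n ∣ IsFibonacci s ]

Γ : ℕ → Graph
Γ n = record
  { Vertex     = FibonacciString n
  ; Adj        = λ x y → ∃! _≡_ (λ i → lookup (value x) i ≢ lookup (value y) i)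
  ; Adj-sym    = λ (i , x≢y , unique) → i , ≢-sym x≢y , λ y≢x → unique (≢-sym y≢x)
  ; Adj-irrefl = λ (_ , x≢x , _) → x≢x refl
  }

------------------------------------------------------------------------
-- The map ρ

ρ-string : ∀ a b {n} → Vec (Fin (a + b)) n → Vec Bool n
ρ-string a b = Vec.map (λ x → a ≤ᵇ toℕ x)

ρ-true⇒≥ : ∀ a b {n} (s : Vec (Fin (a + b)) n) i →
  lookup (ρ-string a b s) i ≡ true → a ≤ toℕ (lookup s i)
ρ-true⇒≥ a b s i e = ≤ᵇ⇒≤ a _
  (Equivalence.from T-≡ (trans (sym (lookup-map i _ s)) e))

-- A letter ≥ a is preceded by 0, and 0 < a is sent to the bit 0.
ρ-isFibonacci : ∀ a b {n} .{{_ : NonZero a}} (s : Vec (Fin (a + b)) n) →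
  IsHoradam a b s → IsFibonacci (ρ-string a b s)
ρ-isFibonacci a b s h i j j≡1+i (eᵢ , eⱼ)
  with i′ , j≡1+i′ , sᵢ′≡0 ← h j (ρ-true⇒≥ a b s j eⱼ)
  with refl ← toℕ-injective (suc-injective (trans (sym j≡1+i) j≡1+i′)) =
  <-irrefl (sym sᵢ′≡0) (<-≤-trans (>-nonZero⁻¹ a) (ρ-true⇒≥ a b s i eᵢ))

ρ : ∀ a b n .{{_ : NonZero a}} → Vertex (Π a b n) → FibonacciString n
ρ a b n = Refinement.map (ρ-string a b) (λ {s} → ρ-isFibonacci a b s)

{-# OPTIONS --safe #-}
-- Cut a Horadam string into blocks: a single letter < a, or a letter 0
-- followed by a letter ≥ a.  The cut is a tiling of a row of n cells by tiles
-- of length 1 and 2, and there are F_{n+1} tilings.  The strings with a given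
-- tiling choose a letter in each block independently, so they induce a product
-- of copies of P_a (short tiles) and P_b (long tiles).
--
-- The image of ρ consists of the words 0w with w a Fibonacci word.  One edge
-- of Π changes one letter by 1, so it changes at most one bit.  Conversely, if
-- two such words differ in exactly one bit, choose the letters a − 1 and a at
-- this bit, and everywhere else 0 and a for the bits 0 and 1: the bits next
-- to the changed one are 0 in both words, so both strings are Horadam.
module Submission where

open import Defs
open import Data.Bool.Base using (Bool; true; false; if_then_else_)
import Data.Bool.Properties as Bool
open import Data.Fin.Base
  using (Fin; zero; suc; toℕ; fromℕ; inject₁; lower; reduce≥; splitAt; join; _↑ˡ_; _↑ʳ_)
open import Data.Fin.Properties
  using (toℕ-↑ˡ; toℕ-↑ʳ; ↑ˡ-injective; ↑ʳ-injective; toℕ-injective; toℕ<n;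
         toℕ-fromℕ; toℕ-inject₁; splitAt-↑ˡ; splitAt-↑ʳ; join-splitAt)
import Data.Fin.Properties as Fin
open import Data.Irrelevant using ([_])
open import Data.List.Base using (List; []; _∷_)
open import Data.Nat.Base
  using (ℕ; zero; suc; pred; _+_; _≤_; _<_; _≤ᵇ_; ∣_-_∣; NonZero; z≤n; s≤s)
open import Data.Nat.Properties
open import Data.Product.Base using (_×_; _,_; proj₁; proj₂; ∃-syntax)
open import Data.Product using (∃!)
open import Data.Product.Function.NonDependent.Propositional using (_×-⇔_)
open import Data.Refinement using (value; value-injective; _,_)
open import Data.Sum.Base using (_⊎_; inj₁; inj₂; [_,_]; [_,_]′)
open import Data.Sum.Function.Propositional using (_⊎-⇔_)
open import Data.Unit.Base using (⊤; tt)
open import Data.Vec.Base using (Vec; []; _∷_; lookup; zipWith; head)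
open import Data.Vec.Properties using (∷-injective; ∷-injectiveʳ; lookup-zipWith)
open import Function.Base using (_∘_)
open import Function.Bundles using (_⇔_; mk⇔; mk↔ₛ′; Equivalence)
open import Function.Construct.Composition using (_⇔-∘_)
open import Function.Construct.Identity using (⇔-id)
open import Relation.Binary.PropositionalEquality
open import Relation.Nullary using (¬_; yes; no; contradiction; recompute)
open import Relation.Nullary.Decidable using (decidable-stable)

open Graph using (Adj)

-- Sums equal to 1, indices in a sum of two ranges, threshold bits

m+n≡1⇔ : ∀ m {n} → m + n ≡ 1 ⇔ ((m ≡ 0 × n ≡ 1) ⊎ (m ≡ 1 × n ≡ 0))
m+n≡1⇔ m = mk⇔ (to m) λ { (inj₁ (refl , refl)) → refl ; (inj₂ (refl , refl)) → refl }
  where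
  to : ∀ m {n} → m + n ≡ 1 → (m ≡ 0 × n ≡ 1) ⊎ (m ≡ 1 × n ≡ 0)
  to 0     e = inj₁ (refl , e)
  to 1 {0} e = inj₂ (refl , refl)

↑ˡ-lower : ∀ {m n} (i : Fin (m + n)) .(i<m : toℕ i < m) → lower i i<m ↑ˡ n ≡ i
↑ˡ-lower {suc m} zero    _   = refl
↑ˡ-lower {suc m} (suc i) i<m = cong suc (↑ˡ-lower i _)

↑ʳ-reduce≥ : ∀ m {n} (i : Fin (m + n)) .(m≤i : m ≤ toℕ i) → m ↑ʳ reduce≥ i m≤i ≡ i
↑ʳ-reduce≥ zero    i       _   = refl
↑ʳ-reduce≥ (suc m) (suc i) m≤i = cong suc (↑ʳ-reduce≥ m i _)

≤⇒≤ᵇ≡true : ∀ {m n} → m ≤ n → (m ≤ᵇ n) ≡ true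
≤⇒≤ᵇ≡true m≤n = Equivalence.to Bool.T-≡ (≤⇒≤ᵇ m≤n)

≤ᵇ≡true⇒≤ : ∀ {m n} → (m ≤ᵇ n) ≡ true → m ≤ n
≤ᵇ≡true⇒≤ e = ≤ᵇ⇒≤ _ _ (Equivalence.from Bool.T-≡ e)

>⇒≤ᵇ≡false : ∀ {m n} → n < m → (m ≤ᵇ n) ≡ false
>⇒≤ᵇ≡false n<m = Bool.¬-not (<⇒≱ n<m ∘ ≤ᵇ≡true⇒≤)

-- Tilings

data Tiling : ℕ → Set where
  []    : Tiling 0
  short : ∀ {n} → Tiling n → Tiling (suc n)
  long  : ∀ {n} → Tiling n → Tiling (suc (suc n))

-- The two summands of the Fibonacci recursion number the tilings by their first tile.
index : ∀ {n} → Tiling n → Fin (fib (suc n))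
index []            = zero
index (short {n} t) = index t ↑ˡ fib n
index (long {n} t)  = fib (suc (suc n)) ↑ʳ index t

tiling : ∀ {n} → Fin (fib (suc n)) → Tiling n
tiling {0}           _ = []
-- Here `fib 2` unfolds to `1 + 0`: one cell leaves no room for a long tile.
tiling {1}           _ = short []
tiling {suc (suc n)} i =
  [ short ∘ tiling {suc n} , long ∘ tiling {n} ]′ (splitAt (fib (suc (suc n))) i)

tiling-index : ∀ {n} (t : Tiling n) → tiling (index t) ≡ t
tiling-index []         = refl
tiling-index (short []) = refl
tiling-index (short {suc n} t)
  rewrite splitAt-↑ˡ (fib (suc (suc n))) (index t) (fib (suc n)) =
  cong short (tiling-index t)
tiling-index (long {n} t)
  rewrite splitAt-↑ʳ (fib (suc (suc n))) (fib (suc n)) (index t) =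
  cong long (tiling-index t)

index-tiling : ∀ {n} (i : Fin (fib (suc n))) → index (tiling {n} i) ≡ i
index-tiling {0}           zero = refl
index-tiling {1}           zero = refl
index-tiling {suc (suc n)} i = trans
  -- The motive compares with `join` for an arbitrary value of `splitAt`; `join-splitAt` then leads
  -- back to `i`.
  ([_,_] {C = λ x → index ([ short ∘ tiling {suc n} , long ∘ tiling {n} ]′ x) ≡ join _ _ x}
    (λ j → cong (_↑ˡ fib (suc n)) (index-tiling {suc n} j))
    (λ j → cong (fib (suc (suc n)) ↑ʳ_) (index-tiling {n} j))
    (splitAt (fib (suc (suc n))) i))
  (join-splitAt (fib (suc (suc n))) (fib (suc n)) i)

distance≡0⇒≡ : ∀ {m n} (xs ys : Vec (Fin m) n) → distance xs ys ≡ 0 → xs ≡ ys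
distance≡0⇒≡ []       []       _ = refl
distance≡0⇒≡ (x ∷ xs) (y ∷ ys) e = cong₂ _∷_
  (toℕ-injective (∣m-n∣≡0⇒m≡n (m+n≡0⇒m≡0 ∣ toℕ x - toℕ y ∣ e)))
  (distance≡0⇒≡ xs ys (m+n≡0⇒n≡0 ∣ toℕ x - toℕ y ∣ e))

-- Decomposition into grids

-- The parameters are the predecessors of the paper's a and b.
module _ (a′ b′ : ℕ) where

  private
    a = suc a′
    b = suc b′

    Letter = Fin (a + b)

  -- Dropping `x` could only remove the 0 required before `y`, and `y` is too small to require one.
  isHoradam-tail : ∀ {n} {x y : Letter} {s : Vec Letter n} →
    toℕ y < a → IsHoradam a b (x ∷ y ∷ s) → IsHoradam a b (y ∷ s)
  isHoradam-tail y<a h zero    a≤y  = contradiction a≤y (<⇒≱ y<a)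
  isHoradam-tail y<a h (suc j) a≤sⱼ with h (suc (suc j)) a≤sⱼ
  ... | suc i , e , sᵢ≡0 = i , suc-injective e , sᵢ≡0

  -- The first letter of `s` cannot be large: it would need a 0 before it, but `y` is at least `a`,
  -- hence positive.
  isHoradam-tail² : ∀ {n} {x y : Letter} {s : Vec Letter n} →
    a ≤ toℕ y → IsHoradam a b (x ∷ y ∷ s) → toℕ x ≡ 0 × IsHoradam a b s
  isHoradam-tail² {x = x} {y} {s} a≤y h = x≡0 , h′
    where
    x≡0 : toℕ x ≡ 0
    x≡0 with zero , _ , x≡0 ← h (suc zero) a≤y = x≡0
    h′ : IsHoradam a b s
    h′ j a≤sⱼ with h (suc (suc j)) a≤sⱼ
    ... | suc zero    , _ , y≡0  = contradiction (subst (a ≤_) y≡0 a≤y) λ ()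
    ... | suc (suc i) , e , sᵢ≡0 = i , suc-injective (suc-injective e) , sᵢ≡0

  isHoradam-∷ : ∀ {n} {x : Letter} {s : Vec Letter n} →
    toℕ x < a → IsHoradam a b s → IsHoradam a b (x ∷ s)
  isHoradam-∷ x<a h zero    a≤x  = contradiction x<a (≤⇒≯ a≤x)
  isHoradam-∷ x<a h (suc j) a≤sⱼ with i , e , sᵢ≡0 ← h j a≤sⱼ = suc i , cong suc e , sᵢ≡0

  isHoradam-∷∷ : ∀ {n} {x y : Letter} {s : Vec Letter n} →
    toℕ x ≡ 0 → IsHoradam a b s → IsHoradam a b (x ∷ y ∷ s)
  isHoradam-∷∷ x≡0 h zero          a≤x  = contradiction (subst (a ≤_) x≡0 a≤x) λ ()
  isHoradam-∷∷ x≡0 h (suc zero)    _    = zero , refl , x≡0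
  isHoradam-∷∷ x≡0 h (suc (suc j)) a≤sⱼ with i , e , sᵢ≡0 ← h j a≤sⱼ =
    suc (suc i) , cong (2 +_) e , sᵢ≡0

  -- No condition relates two different tiles, so the letters of distinct tiles vary independently;
  -- this is the source of the product structure.
  Tiled : ∀ {n} → Tiling n → Vec Letter n → Set
  Tiled []        []          = ⊤
  Tiled (short t) (x ∷ s)     = toℕ x < a × Tiled t s
  Tiled (long t)  (x ∷ y ∷ s) = toℕ x ≡ 0 × a ≤ toℕ y × Tiled t s

  -- The second letter alone decides the first tile, so the cut is defined for every word; that the
  -- word fits it is proved for Horadam strings only.
  shape : ∀ {n} → Vec Letter n → Tiling n
  shape []          = []
  shape (x ∷ [])    = short []
  shape (x ∷ y ∷ s) = if a ≤ᵇ toℕ y then long (shape s) else short (shape (y ∷ s))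

  shape-short : ∀ {n} x {y} (s : Vec Letter n) → toℕ y < a →
    shape (x ∷ y ∷ s) ≡ short (shape (y ∷ s))
  shape-short _ _ y<a rewrite >⇒≤ᵇ≡false y<a = refl

  shape-long : ∀ {n} x {y} (s : Vec Letter n) → a ≤ toℕ y →
    shape (x ∷ y ∷ s) ≡ long (shape s)
  shape-long _ _ a≤y rewrite ≤⇒≤ᵇ≡true a≤y = refl

  head<a : ∀ {n} (t : Tiling (suc n)) x (s : Vec Letter n) → Tiled t (x ∷ s) → toℕ x < a
  head<a (short t) x s       (x<a , _) = x<a
  head<a (long t)  x (y ∷ s) (x≡0 , _) = subst (_< a) (sym x≡0) (s≤s z≤n)

  isHoradam-head<a : ∀ {n} {x : Letter} {s : Vec Letter n} → IsHoradam a b (x ∷ s) → toℕ x < a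
  isHoradam-head<a h = ≰⇒> λ a≤x → contradiction (proj₁ (proj₂ (h zero a≤x))) λ ()

  tiled-shape : ∀ {n} (s : Vec Letter n) → IsHoradam a b s → Tiled (shape s) s
  tiled-shape []          h = tt
  tiled-shape (x ∷ [])    h = isHoradam-head<a h , tt
  tiled-shape (x ∷ y ∷ s) h =
    [ (λ y<a → subst tiledBy (sym (shape-short x s y<a))
        (isHoradam-head<a h , tiled-shape (y ∷ s) (isHoradam-tail y<a h)))
    , (λ a≤y → let x≡0 , h′ = isHoradam-tail² a≤y h in
        subst tiledBy (sym (shape-long x s a≤y)) (x≡0 , a≤y , tiled-shape s h′))
    ]′ (<-≤-connex (toℕ y) a)
    where
    tiledBy : Tiling _ → Set
    tiledBy t = Tiled t (x ∷ y ∷ s)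

  tiled⇒isHoradam : ∀ {n} (t : Tiling n) (s : Vec Letter n) → Tiled t s → IsHoradam a b s
  tiled⇒isHoradam []        []          _               ()
  tiled⇒isHoradam (short t) (x ∷ s)     (x<a , p)       = isHoradam-∷ x<a (tiled⇒isHoradam t s p)
  tiled⇒isHoradam (long t)  (x ∷ y ∷ s) (x≡0 , _ , p) = isHoradam-∷∷ x≡0 (tiled⇒isHoradam t s p)

  -- A tiling can be read off from the string: the letter after a short tile begins another tile,
  -- hence is less than `a` by `head<a`, while a long tile shows a letter at least `a` in second
  -- place.
  tiled⇒shape : ∀ {n} (t : Tiling n) (s : Vec Letter n) → Tiled t s → shape s ≡ t
  tiled⇒shape []         []          _ = refl
  tiled⇒shape (short []) (x ∷ [])    _ = refl
  tiled⇒shape (short t)  (x ∷ y ∷ s) (_ , p) =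
    trans (shape-short x s (head<a t y s p)) (cong short (tiled⇒shape t (y ∷ s) p))
  tiled⇒shape (long t)   (x ∷ y ∷ s) (_ , a≤y , p) =
    trans (shape-long x s a≤y) (cong long (tiled⇒shape t s p))

  -- Grid coordinates on the strings with a given tiling

  dims : ∀ {n} → Tiling n → List ℕ
  dims []        = []
  dims (short t) = a ∷ dims t
  dims (long t)  = b ∷ dims t

  word : ∀ {n} (t : Tiling n) → Vertex (grid (dims t)) → Vec Letter n
  word []        _       = []
  word (short t) (x , g) = (x ↑ˡ b) ∷ word t g
  word (long t)  (y , g) = zero ∷ (a ↑ʳ y) ∷ word t g

  -- `Tiled` is an irrelevant argument because vertices of `Π` and of induced subgraphs carry only
  -- irrelevant membership proofs.
  coords : ∀ {n} (t : Tiling n) (s : Vec Letter n) → .(Tiled t s) → Vertex (grid (dims t))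
  coords []        []          _ = zero
  coords (short t) (x ∷ s)     p = lower x (proj₁ p) , coords t s (proj₂ p)
  coords (long t)  (x ∷ y ∷ s) p = reduce≥ y (proj₁ (proj₂ p)) , coords t s (proj₂ (proj₂ p))

  origin : ∀ {n} (t : Tiling n) → Vertex (grid (dims t))
  origin []        = zero
  origin (short t) = zero , origin t
  origin (long t)  = zero , origin t

  tiled-word : ∀ {n} (t : Tiling n) g → Tiled t (word t g)
  tiled-word []        _       = tt
  tiled-word (short t) (x , g) =
    subst (_< a) (sym (toℕ-↑ˡ x b)) (toℕ<n x) , tiled-word t g
  tiled-word (long t)  (y , g) =
    refl , subst (a ≤_) (sym (toℕ-↑ʳ a y)) (m≤m+n a (toℕ y)) , tiled-word t g

  word-injective : ∀ {n} (t : Tiling n) {g h} → word t g ≡ word t h → g ≡ h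
  word-injective []        {zero}  {zero}  _ = refl
  word-injective (short t) {x , _} {y , _} e with e₁ , e₂ ← ∷-injective e =
    cong₂ _,_ (↑ˡ-injective b x y e₁) (word-injective t e₂)
  word-injective (long t)  {x , _} {y , _} e with e₁ , e₂ ← ∷-injective (∷-injectiveʳ e) =
    cong₂ _,_ (↑ʳ-injective a x y e₁) (word-injective t e₂)

  word-coords : ∀ {n} (t : Tiling n) (s : Vec Letter n) .(p : Tiled t s) →
    word t (coords t s p) ≡ s
  word-coords []        []          _ = refl
  word-coords (short t) (x ∷ s)     p = cong₂ _∷_ (↑ˡ-lower x _) (word-coords t s _)
  word-coords (long t)  (x ∷ y ∷ s) p = cong₂ _∷_
    -- Only an irrelevant proof that `x` is 0 is at hand; decidability of equality yields a usable
    -- one.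
    (toℕ-injective (sym (recompute (toℕ x ≟ 0) (proj₁ p))))
    (cong₂ _∷_ (↑ʳ-reduce≥ a y _) (word-coords t s _))

  word-distance≡0 : ∀ {n} (t : Tiling n) {g h} → distance (word t g) (word t h) ≡ 0 ⇔ g ≡ h
  word-distance≡0 t = mk⇔
    (λ e → word-injective t (distance≡0⇒≡ _ _ e))
    (λ { refl → distance-self (word t _) })

  -- `k` stands for the distance over the remaining tiles. A sum equal to 1 has one summand 0 and
  -- the other 1, matching the two clauses of adjacency in `_□_`.
  □-adjacent : ∀ {m k} {H : Graph} {x y : Fin m} {g h : Vertex H} →
    k ≡ 0 ⇔ g ≡ h → k ≡ 1 ⇔ Adj H g h →
    ∣ toℕ x - toℕ y ∣ + k ≡ 1 ⇔ Adj (path m □ H) (x , g) (y , h)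
  □-adjacent {x = x} {y} k≡0 k≡1 =
    ((mk⇔ (toℕ-injective ∘ ∣m-n∣≡0⇒m≡n) (m≡n⇒∣m-n∣≡0 ∘ cong toℕ) ×-⇔ k≡1)
      ⊎-⇔ (⇔-id _ ×-⇔ k≡0))
    ⇔-∘ m+n≡1⇔ ∣ toℕ x - toℕ y ∣

  -- Each coordinate becomes a letter by a translation, by 0 or by `a`, and the 0 of a long tile
  -- adds no distance.
  word-adjacent : ∀ {n} (t : Tiling n) g h →
    distance (word t g) (word t h) ≡ 1 ⇔ Adj (grid (dims t)) g h
  word-adjacent []        zero    zero    = mk⇔ (λ ()) (λ ())
  word-adjacent (short t) (x , g) (y , h)
    rewrite toℕ-↑ˡ x b | toℕ-↑ˡ y b =
    □-adjacent {H = grid (dims t)} (word-distance≡0 t) (word-adjacent t g h)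
  word-adjacent (long t)  (x , g) (y , h)
    -- One successor on each side has already cancelled by computation, so the common shift left is
    -- `a′`.
    rewrite toℕ-↑ʳ a′ x | toℕ-↑ʳ a′ y | ∣m+n-m+o∣≡∣n-o∣ a′ (toℕ x) (toℕ y) =
    □-adjacent {H = grid (dims t)} (word-distance≡0 t) (word-adjacent t g h)

  fiber≅grid : ∀ {n} (t : Tiling n) →
    induced (Π a b n) (λ v → shape (value v) ≡ t) ≅ grid (dims t)
  fiber≅grid t = record
    { vertices = mk↔ₛ′ to from
        -- This inverse law follows from the other one, `word-coords`, by injectivity of `word`.
        (λ g → word-injective t (word-coords t (word t g) (tiled-word t g)))
        (λ v → value-injective (value-injective (word-to v)))
    ; adjacent = λ u v → subst₂
        (λ s s′ → distance s s′ ≡ 1 ⇔ Adj (grid (dims t)) (to u) (to v))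
        (word-to u) (word-to v) (word-adjacent t (to u) (to v))
    }
    where
    F = induced (Π a b _) (λ v → shape (value v) ≡ t)

    tiled : ∀ s → IsHoradam a b s → shape s ≡ t → Tiled t s
    tiled s h refl = tiled-shape s h

    to : Vertex F → Vertex (grid (dims t))
    to ((s , [ h ]) , [ e ]) = coords t s (tiled s h e)

    from : Vertex (grid (dims t)) → Vertex F
    from g = (word t g , [ tiled⇒isHoradam t _ (tiled-word t g) ])
           , [ tiled⇒shape t _ (tiled-word t g) ]

    word-to : ∀ v → word t (to v) ≡ value (value v)
    word-to ((s , [ h ]) , [ e ]) = word-coords t s (tiled s h e)

  decomposes : ∀ n → DecomposesIntoGrids (Π a b n) (fib (suc n))
  decomposes n = (λ i v → shape (value v) ≡ tiling i) , record
    -- The point `origin` exists because the side lengths `a` and `b` are positive.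
    { nonempty = λ i → let t = tiling {n} i ; p = tiled-word t (origin t) in
        (word t (origin t) , [ tiled⇒isHoradam t _ p ]) , tiled⇒shape t _ p
    ; covers!  = λ v → index (shape (value v)) , sym (tiling-index _) ,
        λ {i} e → trans (cong index e) (index-tiling {n} i)
    } , λ i → dims (tiling {n} i) , fiber≅grid (tiling i)

-- Hamming distance of binary words

bit-distance : Bool → Bool → ℕ
bit-distance false false = 0
bit-distance true  true  = 0
bit-distance _     _     = 1

bit-distance≡0⇒≡ : ∀ {x y} → bit-distance x y ≡ 0 → x ≡ y
bit-distance≡0⇒≡ {false} {false} _ = refl
bit-distance≡0⇒≡ {true}  {true}  _ = refl

bit-distance-self : ∀ x → bit-distance x x ≡ 0
bit-distance-self false = refl
bit-distance-self true  = refl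

bit-distance≡1⇔≢ : ∀ x y → bit-distance x y ≡ 1 ⇔ x ≢ y
bit-distance≡1⇔≢ false false = mk⇔ (λ ()) (λ x≢x → contradiction refl x≢x)
bit-distance≡1⇔≢ true  true  = mk⇔ (λ ()) (λ x≢x → contradiction refl x≢x)
bit-distance≡1⇔≢ false true  = mk⇔ (λ _ ()) (λ _ → refl)
bit-distance≡1⇔≢ true  false = mk⇔ (λ _ ()) (λ _ → refl)

-- Unlike the unique differing position in `Γ`, a sum over positions can be compared with `distance`
-- term by term.
hamming : ∀ {n} → Vec Bool n → Vec Bool n → ℕ
hamming []       []       = 0
hamming (x ∷ xs) (y ∷ ys) = bit-distance x y + hamming xs ys

hamming-self : ∀ {n} (xs : Vec Bool n) → hamming xs xs ≡ 0
hamming-self []       = refl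
hamming-self (x ∷ xs) = cong₂ _+_ (bit-distance-self x) (hamming-self xs)

hamming≡0⇒≡ : ∀ {n} (xs ys : Vec Bool n) → hamming xs ys ≡ 0 → xs ≡ ys
hamming≡0⇒≡ []       []       _ = refl
hamming≡0⇒≡ (x ∷ xs) (y ∷ ys) e = cong₂ _∷_
  (bit-distance≡0⇒≡ (m+n≡0⇒m≡0 (bit-distance x y) e))
  (hamming≡0⇒≡ xs ys (m+n≡0⇒n≡0 (bit-distance x y) e))

lookup-≗⇒≡ : ∀ {n} (xs ys : Vec Bool n) → (∀ i → lookup xs i ≡ lookup ys i) → xs ≡ ys
lookup-≗⇒≡ []       []       _ = refl
lookup-≗⇒≡ (x ∷ xs) (y ∷ ys) e = cong₂ _∷_ (e zero) (lookup-≗⇒≡ xs ys (e ∘ suc))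

DifferOnce : ∀ {n} → Vec Bool n → Vec Bool n → Set
DifferOnce xs ys = ∃! _≡_ λ i → lookup xs i ≢ lookup ys i

hamming≡1⇒differOnce : ∀ {n} (xs ys : Vec Bool n) → hamming xs ys ≡ 1 → DifferOnce xs ys
hamming≡1⇒differOnce []       []       ()
hamming≡1⇒differOnce (x ∷ xs) (y ∷ ys) e
  with Equivalence.to (m+n≡1⇔ (bit-distance x y)) e
... | inj₂ (d , r) with refl ← hamming≡0⇒≡ xs ys r =
  zero , Equivalence.to (bit-distance≡1⇔≢ x y) d ,
  λ { {zero} _ → refl ; {suc i} ≢ → contradiction refl ≢ }
... | inj₁ (d , r) with i , ≢ , unique ← hamming≡1⇒differOnce xs ys r =
  suc i , ≢ ,
  λ { {zero} ≢ → contradiction (bit-distance≡0⇒≡ d) ≢ ; {suc j} ≢ → cong suc (unique ≢) }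

differOnce⇒hamming≡1 : ∀ {n} (xs ys : Vec Bool n) → DifferOnce xs ys → hamming xs ys ≡ 1
differOnce⇒hamming≡1 (x ∷ xs) (y ∷ ys) (zero , ≢ , unique) =
  cong₂ _+_ (Equivalence.from (bit-distance≡1⇔≢ x y) ≢)
    (trans (cong (hamming xs) (sym xs≡ys)) (hamming-self xs))
  where
  xs≡ys : xs ≡ ys
  -- A difference in the tails would be a second differing position.
  xs≡ys = lookup-≗⇒≡ xs ys λ i → decidable-stable (lookup xs i Bool.≟ lookup ys i)
    λ ≢ → contradiction (unique {suc i} ≢) λ ()
differOnce⇒hamming≡1 (x ∷ xs) (y ∷ ys) (suc i , ≢ , unique) with x Bool.≟ y
... | no  x≢y  = contradiction (unique {zero} x≢y) λ ()
... | yes refl = cong₂ _+_ (bit-distance-self x)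
  (differOnce⇒hamming≡1 xs ys (i , ≢ , λ ≢ → Fin.suc-injective (unique ≢)))

differOnce-sym : ∀ {n} {xs ys : Vec Bool n} → DifferOnce xs ys → DifferOnce ys xs
differOnce-sym (i , ≢ , unique) = i , ≢-sym ≢ , unique ∘ ≢-sym

-- The quotient by ρ

isFibonacci-tail : ∀ {n x} {p : Vec Bool n} → IsFibonacci (x ∷ p) → IsFibonacci p
isFibonacci-tail f i j e = f (suc i) (suc j) (cong suc e)

isFibonacci-0∷ : ∀ {n} {p : Vec Bool n} → IsFibonacci p → IsFibonacci (false ∷ p)
isFibonacci-0∷ f (suc i) (suc j) e = f i j (suc-injective e)

-- In the lifts below, `a − 1` stands where only `q` has a 1; the condition keeps it away from the
-- place just before an `a`. For `q = p` it unfolds to `IsFibonacci p`.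
Compatible : ∀ {n} → Vec Bool n → Vec Bool n → Set
Compatible q p = ∀ i j → toℕ j ≡ suc (toℕ i) → ¬ (lookup q i ≡ true × lookup p j ≡ true)

-- If `q` has a 1 at `i` and `p` a 1 at the next position `j`, then `p` has 0 at `i` and `q` has 0
-- at `j`, so the words differ twice.
differOnce⇒compatible : ∀ {n} {p q : Vec Bool n} → IsFibonacci p → IsFibonacci q →
  DifferOnce p q → Compatible q p
differOnce⇒compatible {p = p} {q} fp fq (k , _ , unique) i j e (qᵢ , pⱼ) =
  1+n≢n (sym (trans (cong toℕ i≡j) e))
  where
  pᵢ≢qᵢ : lookup p i ≢ lookup q i
  pᵢ≢qᵢ pᵢ≡qᵢ = fp i j e (trans pᵢ≡qᵢ qᵢ , pⱼ)
  pⱼ≢qⱼ : lookup p j ≢ lookup q j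
  pⱼ≢qⱼ pⱼ≡qⱼ = fq i j e (qᵢ , trans (sym pⱼ≡qⱼ) pⱼ)
  i≡j : i ≡ j
  i≡j = trans (sym (unique pᵢ≢qᵢ)) (unique pⱼ≢qⱼ)

-- Lifts of binary words and the isomorphism with the Fibonacci cube

module _ (a′ b′ : ℕ) where

  private
    a = suc a′
    b = suc b′

    Letter = Fin (a + b)

  -- Exchanging the two bits moves the letter by 1 if they differ and not at all if they agree.
  letter : Bool → Bool → Letter
  letter true  _     = a ↑ʳ zero
  letter false true  = fromℕ a′ ↑ˡ b
  letter false false = zero

  toℕ-a : toℕ (letter true true) ≡ a
  toℕ-a = trans (toℕ-↑ʳ a (zero {b′})) (+-identityʳ a)

  toℕ-a-1 : toℕ (letter false true) ≡ a′
  toℕ-a-1 = trans (toℕ-↑ˡ (fromℕ a′) b) (toℕ-fromℕ a′)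

  ρ-letter : ∀ x y → (a ≤ᵇ toℕ (letter x y)) ≡ x
  ρ-letter true  _     = ≤⇒≤ᵇ≡true (≤-reflexive (sym toℕ-a))
  ρ-letter false false = refl
  ρ-letter false true  = >⇒≤ᵇ≡false (s≤s (≤-reflexive toℕ-a-1))

  distance-letter : ∀ x y → ∣ toℕ (letter x y) - toℕ (letter y x) ∣ ≡ bit-distance x y
  distance-letter false false = refl
  distance-letter true  true  = ∣n-n∣≡0 (toℕ (letter true true))
  distance-letter true  false =
    trans (cong₂ ∣_-_∣ toℕ-a toℕ-a-1) (∣1+n-n∣≡1 a′)
    where
    ∣1+n-n∣≡1 : ∀ n → ∣ suc n - n ∣ ≡ 1
    ∣1+n-n∣≡1 zero    = refl
    ∣1+n-n∣≡1 (suc n) = ∣1+n-n∣≡1 n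
  distance-letter false true  =
    trans (∣-∣-comm (toℕ (letter false true)) (toℕ (letter true true)))
      (distance-letter true false)

  -- The bits of lift p q are those of p; the bits of q only decide between
  -- the letters 0 and a − 1 for the bit 0.
  lift : ∀ {n} → Vec Bool n → Vec Bool n → Vec Letter n
  lift = zipWith letter

  ρ-lift : ∀ {n} (p q : Vec Bool n) → ρ-string a b (lift p q) ≡ p
  ρ-lift []      []      = refl
  ρ-lift (x ∷ p) (y ∷ q) = cong₂ _∷_ (ρ-letter x y) (ρ-lift p q)

  distance-lift : ∀ {n} (p q : Vec Bool n) → distance (lift p q) (lift q p) ≡ hamming p q
  distance-lift []      []      = refl
  distance-lift (x ∷ p) (y ∷ q) = cong₂ _+_ (distance-letter x y) (distance-lift p q)

  -- Before a 1 of `p`, the first word has 0 by the Fibonacci condition and the second by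
  -- compatibility, so the letter there is `letter false false`. The leading 0 provides this
  -- predecessor for the first bit of `p`.
  isHoradam-lift : ∀ {n} (p q : Vec Bool n) → IsFibonacci (false ∷ p) →
    Compatible (false ∷ q) (false ∷ p) → IsHoradam a b (lift (false ∷ p) (false ∷ q))
  isHoradam-lift p q fp c (suc j) a≤sⱼ = inject₁ j , e , sᵢ≡0
    where
    P = false ∷ p
    Q = false ∷ q

    Pⱼ : lookup P (suc j) ≡ true
    Pⱼ = trans (sym (ρ-letter (lookup p j) (lookup q j)))
      (≤⇒≤ᵇ≡true (subst (λ l → a ≤ toℕ l) (lookup-zipWith letter j p q) a≤sⱼ))

    e : toℕ (suc j) ≡ suc (toℕ (inject₁ j))
    e = cong suc (sym (toℕ-inject₁ j))

    Pᵢ : lookup P (inject₁ j) ≡ false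
    Pᵢ = Bool.¬-not λ Pᵢ → fp (inject₁ j) (suc j) e (Pᵢ , Pⱼ)

    Qᵢ : lookup Q (inject₁ j) ≡ false
    Qᵢ = Bool.¬-not λ Qᵢ → c (inject₁ j) (suc j) e (Qᵢ , Pⱼ)

    sᵢ≡0 : toℕ (lookup (lift P Q) (inject₁ j)) ≡ 0
    sᵢ≡0 = cong toℕ (trans (lookup-zipWith letter (inject₁ j) P Q) (cong₂ letter Pᵢ Qᵢ))

  liftVertex : ∀ {n} (p q : Vec Bool n) →
    .(IsFibonacci p) → .(Compatible (false ∷ q) (false ∷ p)) → Vertex (Π a b (suc n))
  liftVertex p q fp c =
    lift (false ∷ p) (false ∷ q) , [ isHoradam-lift p q (isFibonacci-0∷ fp) c ]

  -- Two bits are at distance at most 1, and unequal numbers already at distance at least 1.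
  bit-distance-ρ : ∀ m x y → bit-distance (m ≤ᵇ x) (m ≤ᵇ y) ≤ ∣ x - y ∣
  bit-distance-ρ m x y with x ≟ y
  ... | yes refl = ≤-trans (≤-reflexive (bit-distance-self (m ≤ᵇ x))) z≤n
  ... | no  x≢y  = ≤-trans (≤1 (m ≤ᵇ x) (m ≤ᵇ y)) (n≢0⇒n>0 (x≢y ∘ ∣m-n∣≡0⇒m≡n))
    where
    ≤1 : ∀ x y → bit-distance x y ≤ 1
    ≤1 false false = z≤n
    ≤1 true  true  = z≤n
    ≤1 false true  = ≤-refl
    ≤1 true  false = ≤-refl

  hamming-ρ : ∀ {n} (s s′ : Vec Letter n) →
    hamming (ρ-string a b s) (ρ-string a b s′) ≤ distance s s′
  hamming-ρ []      []        = z≤n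
  hamming-ρ (x ∷ s) (y ∷ s′) = +-mono-≤ (bit-distance-ρ a (toℕ x) (toℕ y)) (hamming-ρ s s′)

  quotient≅Γ : ∀ m → quotient (Π a b (suc m)) (ρ a b (suc m)) ≅ Γ m
  quotient≅Γ m = record
    { vertices = mk↔ₛ′ to from (λ _ → refl) from-to
    ; adjacent = λ w₁ w₂ → mk⇔ (forth w₁ w₂) (back w₁ w₂)
    }
    where
    Q = quotient (Π a b (suc m)) (ρ a b (suc m))

    bits : Vertex Q → Vec Bool (suc m)
    bits w = value (value w)

    to : Vertex Q → FibonacciString m
    to ((_ ∷ p , [ f ]) , _) = p , [ isFibonacci-tail f ]

    from : FibonacciString m → Vertex Q
    from (p , [ f ]) = (false ∷ p , [ isFibonacci-0∷ f ]) ,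
      -- Lifting `p` against itself uses only the letters 0 and `a`.
      [ (liftVertex p p f (isFibonacci-0∷ f) , value-injective (ρ-lift (false ∷ p) (false ∷ p))) ]

    ρ-head : ∀ v → head (value (ρ a b (suc m) v)) ≡ false
    ρ-head (x ∷ s , [ h ]) =
      recompute (_ Bool.≟ _) (>⇒≤ᵇ≡false (isHoradam-head<a a′ b′ h))

    image-head : (w : FibonacciString (suc m)) → ∃[ v ] ρ a b (suc m) v ≡ w →
      head (value w) ≡ false
    image-head w (v , ρv≡w) = trans (cong (head ∘ value) (sym ρv≡w)) (ρ-head v)

    bits≡ : ∀ w → bits w ≡ false ∷ value (to w)
    bits≡ ((x ∷ p , f) , [ im ]) =
      cong (_∷ p) (recompute (x Bool.≟ false) (image-head (x ∷ p , f) im))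

    from-to : ∀ w → from (to w) ≡ w
    from-to w = value-injective (value-injective (sym (bits≡ w)))

    hamming-bits : ∀ w₁ w₂ → hamming (bits w₁) (bits w₂) ≡ hamming (value (to w₁)) (value (to w₂))
    hamming-bits w₁ w₂ = cong₂ hamming (bits≡ w₁) (bits≡ w₂)

    forth : ∀ w₁ w₂ → Adj Q w₁ w₂ → Adj (Γ m) (to w₁) (to w₂)
    forth w₁ w₂ (w₁≢w₂ , v₁ , v₂ , e₁ , e₂ , d) =
      -- An edge changes at most one bit, and distinct vertices of the quotient differ in at least
      -- one.
      hamming≡1⇒differOnce (value (to w₁)) (value (to w₂))
        (trans (sym (hamming-bits w₁ w₂)) (≤-antisym ≤1 ≥1))
      where
      ≤1 : hamming (bits w₁) (bits w₂) ≤ 1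
      ≤1 = subst₂ (λ p q → hamming p q ≤ 1) (cong value e₁) (cong value e₂)
        (≤-trans (hamming-ρ (value v₁) (value v₂)) (≤-reflexive d))
      ≥1 : 1 ≤ hamming (bits w₁) (bits w₂)
      ≥1 = n≢0⇒n>0 λ e → w₁≢w₂ (value-injective (value-injective (hamming≡0⇒≡ _ _ e)))

    compatible : (p q : Vec Bool m) → IsFibonacci p → IsFibonacci q →
      DifferOnce (false ∷ p) (false ∷ q) → Compatible (false ∷ q) (false ∷ p)
    compatible p q fp fq = differOnce⇒compatible {p = false ∷ p} {false ∷ q}
      (isFibonacci-0∷ fp) (isFibonacci-0∷ fq)

    back : ∀ w₁ w₂ → Adj (Γ m) (to w₁) (to w₂) → Adj Q w₁ w₂
    back w₁@((_ ∷ p , [ f ]) , _) w₂@((_ ∷ q , [ g ]) , _) e@(_ , pᵢ≢qᵢ , _) =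
      (λ { refl → pᵢ≢qᵢ refl }) ,
      -- The ends of the edge are the two lifts with exchanged arguments; their distance is the
      -- Hamming distance of the words.
      liftVertex p q (isFibonacci-tail f)
        (compatible p q (isFibonacci-tail f) (isFibonacci-tail g) 0p~0q) ,
      liftVertex q p (isFibonacci-tail g)
        (compatible q p (isFibonacci-tail g) (isFibonacci-tail f)
          (differOnce-sym {xs = false ∷ p} {false ∷ q} 0p~0q)) ,
      value-injective (trans (ρ-lift (false ∷ p) (false ∷ q)) (sym (bits≡ w₁))) ,
      value-injective (trans (ρ-lift (false ∷ q) (false ∷ p)) (sym (bits≡ w₂))) ,
      trans (distance-lift (false ∷ p) (false ∷ q)) h≡1
      where
      h≡1 : hamming (false ∷ p) (false ∷ q) ≡ 1
      h≡1 = differOnce⇒hamming≡1 p q e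
      0p~0q : DifferOnce (false ∷ p) (false ∷ q)
      0p~0q = hamming≡1⇒differOnce (false ∷ p) (false ∷ q) h≡1

theorem3 : (a b n : ℕ) .{{_ : NonZero a}} .{{_ : NonZero b}} .{{_ : NonZero n}} →
    DecomposesIntoGrids (Π a b n) (fib (suc n)) ×
    (quotient (Π a b n) (ρ a b n) ≅ Γ (pred n))
theorem3 (suc a) (suc b) (suc n) = decomposes a b (suc n) , quotient≅Γ a b n
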